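{- Let $Z:=\{Q=(q_n)_{n\in\omega}\in\mathbb{Q}_+^{\omega} : q_n<q_{n+1}\text{ for all }n\in\omega,\ \lim_{n\to\infty}q_n=+\infty\}$, equipped with the metric $d$ given by $d(Q,Q)=0$ and, for $Q\neq Q'$, $d(Q,Q')=2^{ -\min(q_k,q'_k)}$ where $k=\min\{n\in\omega : q_n\neq q'_n\}$. There exists a closed subset of $Z$ whose characteristic function (a function from $Z$ to $\{0,1\}$) is not first return recoverable.
   Context: $\mathbb{Q}_+$ is the set of nonnegative rationals. $(Z,d)$ is a separable ultrametric space. Let $(X,d)$ be a separable metric space, $D=(x_p)_{p\in\omega}$ a dense sequence in $X$ and $x\in X$. The route to $x$ based on $D$ is the sequence $(s'_n[x,D])_{n\in\omega}$ defined by: $s'_0[x,D]:=x_0$; $s'_{n+1}[x,D]:=s'_n[x,D]$ if $x=s'_n[x,D]$; otherwise $s'_{n+1}[x,D]:=x_p$ with $p$ the least integer such that $d(x,x_p)<d(x,s'_n[x,D])$. A function $f:X\to Y$ into a separable metrizable space is first return recoverable (relative to $d$) if there exists a dense sequence $D$ of $X$ such that for every $x\in X$ the sequence $(f(s'_n[x,D]))_n$ tends to $f(x)$. -}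

module Defs where

open import Algebra.Bundles using (CommutativeRing)
import Algebra.Properties.Semiring.Exp as Exp
open import Data.Empty using (⊥; ⊥-elim)
open import Data.Fin.Base using (Fin)
open import Data.Fin.Patterns using (0F; 1F)
open import Data.Integer.Base as ℤ using (ℤ; +_; +[1+_])
import Data.Integer.Properties as ℤₚ
open import Data.Nat.Base as ℕ using (ℕ; zero; suc)
import Data.Nat.Coprimality as Coprimality
import Data.Nat.Properties as ℕₚ
open import Data.Product using (∃; _×_; _,_; proj₁; proj₂)
open import Data.Rational.Base
open import Data.Rational.Properties
import Data.Rational.Unnormalised.Base as ℚᵘ
import Data.Rational.Unnormalised.Properties as ℚᵘₚ
open import Data.Sum.Base as Sum using (_⊎_; inj₁; inj₂)
open import Function.Bundles using (_⇔_; mk⇔)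
open import Level using (0ℓ)
open import Relation.Binary.Core using (Rel)
open import Relation.Binary.Definitions using (tri<; tri≈; tri>)
open import Relation.Binary.PropositionalEquality
open import Relation.Nullary using (¬_; Dec; yes; no)
open import Relation.Nullary.Decidable using (from-yes)
open import Relation.Unary using (Pred)

open Exp (CommutativeRing.semiring +-*-commutativeRing) public
  using (_^_; ^-homo-*; ^-assocʳ)

record ℝ : Set₁ where
  field
    L U         : Pred ℚ 0ℓ
    L-inhabited : ∃ L
    U-inhabited : ∃ U
    L-down      : ∀ {p q} → p < q → L q → L p
    L-open      : ∀ {p} → L p → ∃ λ q → p < q × L q
    U-up        : ∀ {p q} → p < q → U p → U q
    U-open      : ∀ {q} → U q → ∃ λ p → p < q × U p
    disjoint    : ∀ {q} → L q → U q → ⊥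
    located     : ∀ {p q} → p < q → L p ⊎ U q

infix 4 _≃ℝ_ _<ℝ_

_≃ℝ_ : Rel ℝ 0ℓ
x ≃ℝ y = (∀ q → ℝ.L x q ⇔ ℝ.L y q) × (∀ q → ℝ.U x q ⇔ ℝ.U y q)

_<ℝ_ : Rel ℝ 0ℓ
x <ℝ y = ∃ λ q → ℝ.U x q × ℝ.L y q

p<p+1 : ∀ p → p < p + 1ℚ
p<p+1 p = subst (_< p + 1ℚ) (+-identityʳ p) (+-monoʳ-< p (from-yes (0ℚ <? 1ℚ)))

p-1<p : ∀ p → p - 1ℚ < p
p-1<p p = subst (p - 1ℚ <_) (+-identityʳ p) (+-monoʳ-< p (from-yes (- 1ℚ <? 0ℚ)))

fromℚ : ℚ → ℝ
fromℚ c = record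
  { L           = _< c
  ; U           = c <_
  ; L-inhabited = c - 1ℚ , p-1<p c
  ; U-inhabited = c + 1ℚ , p<p+1 c
  ; L-down      = <-trans
  ; L-open      = <-dense
  ; U-up        = λ p<q c<p → <-trans c<p p<q
  ; U-open      = λ c<q → let (p , c<p , p<q) = <-dense c<q in p , p<q , c<p
  ; disjoint    = <-asym
  ; located     = loc
  }
  where
  loc : ∀ {p q} → p < q → p < c ⊎ c < q
  loc {p} p<q with p <? c
  ... | yes p<c = inj₁ p<c
  ... | no  p≮c = inj₂ (≤-<-trans (≮⇒≥ p≮c) p<q)

0ℝ : ℝ
0ℝ = fromℚ 0ℚ

*-monoˡ-≤ : ∀ {z p q} → 0ℚ ≤ z → p ≤ q → p * z ≤ q * z
*-monoˡ-≤ {z} 0≤z = *-monoʳ-≤-nonNeg z {{nonNegative 0≤z}}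

*-monoʳ-≤ : ∀ {z p q} → 0ℚ ≤ z → p ≤ q → z * p ≤ z * q
*-monoʳ-≤ {z} 0≤z = *-monoˡ-≤-nonNeg z {{nonNegative 0≤z}}

*-monoˡ-< : ∀ {z p q} → 0ℚ < z → p < q → p * z < q * z
*-monoˡ-< {z} 0<z = *-monoˡ-<-pos z {{positive 0<z}}

*-monoʳ-< : ∀ {z p q} → 0ℚ < z → p < q → z * p < z * q
*-monoʳ-< {z} 0<z = *-monoʳ-<-pos z {{positive 0<z}}

^-nonneg : ∀ {r} n → 0ℚ ≤ r → 0ℚ ≤ r ^ n
^-nonneg         zero    0≤r = from-yes (0ℚ ≤? 1ℚ)
^-nonneg {r}     (suc n) 0≤r =
  subst (_≤ r * r ^ n) (*-zeroʳ r) (*-monoʳ-≤ 0≤r (^-nonneg n 0≤r))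

^-pos : ∀ {r} n → 0ℚ < r → 0ℚ < r ^ n
^-pos         zero    0<r = from-yes (0ℚ <? 1ℚ)
^-pos {r}     (suc n) 0<r =
  subst (_< r * r ^ n) (*-zeroʳ r) (*-monoʳ-< 0<r (^-pos n 0<r))

^-mono-≤ : ∀ {r s} n → 0ℚ ≤ r → r ≤ s → r ^ n ≤ s ^ n
^-mono-≤ zero    0≤r r≤s = ≤-refl
^-mono-≤ (suc n) 0≤r r≤s =
  ≤-trans (*-monoˡ-≤ (^-nonneg n 0≤r) r≤s)
          (*-monoʳ-≤ (≤-trans 0≤r r≤s) (^-mono-≤ n 0≤r r≤s))

^-mono-< : ∀ {r s} n .{{_ : ℕ.NonZero n}} → 0ℚ ≤ r → r < s → r ^ n < s ^ n
^-mono-< (suc n) 0≤r r<s =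
  ≤-<-trans (*-monoʳ-≤ 0≤r (^-mono-≤ n 0≤r (<⇒≤ r<s)))
            (*-monoˡ-< (^-pos n (≤-<-trans 0≤r r<s)) r<s)

÷-* : ∀ y z → 0ℚ < z → ∃ λ w → w * z ≡ y
÷-* y z 0<z = y * 1/ z , (begin
  y * 1/ z * z    ≡⟨ *-assoc y (1/ z) z ⟩
  y * (1/ z * z)  ≡⟨ cong (y *_) (*-inverseˡ z) ⟩
  y * 1ℚ          ≡⟨ *-identityʳ y ⟩
  y               ∎)
  where
  open ≡-Reasoning
  instance _ = >-nonZero 0<z

*-shrink : ∀ {a y z} → 0ℚ < a → 0ℚ < z → y < a * z →
           ∃ λ b → 0ℚ < b × b < a × y < b * z
*-shrink {a} {y} {z} 0<a 0<z y<az with ÷-* y z 0<z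
... | w , refl with *-cancelʳ-<-nonNeg z {{nonNegative (<⇒≤ 0<z)}} {w} {a} y<az | ≤-total 0ℚ w
... | w<a | inj₁ 0≤w = let (b , w<b , b<a) = <-dense w<a in
                       b , ≤-<-trans 0≤w w<b , b<a , *-monoˡ-< 0<z w<b
... | w<a | inj₂ w≤0 = let (b , 0<b , b<a) = <-dense 0<a in
                       b , 0<b , b<a , *-monoˡ-< 0<z (≤-<-trans w≤0 0<b)

*-grow : ∀ {a y z} → 0ℚ ≤ z → a * z < y → ∃ λ b → a < b × b * z < y
*-grow {a} {y} {z} 0≤z az<y with <-cmp 0ℚ z
... | tri> _ _ z<0 = ⊥-elim (<-irrefl refl (<-≤-trans z<0 0≤z))
... | tri≈ _ refl _ =
  a + 1ℚ , p<p+1 a , subst (_< y) (trans (*-zeroʳ a) (sym (*-zeroʳ (a + 1ℚ)))) az<y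
... | tri< 0<z _ _ with ÷-* y z 0<z
... | w , refl =
  let (b , a<b , b<w) = <-dense (*-cancelʳ-<-nonNeg z {{nonNegative 0≤z}} {a} {w} az<y) in
  b , a<b , *-monoˡ-< 0<z b<w

^-shrink : ∀ {r y} n → 0ℚ < r → y < r ^ n → ∃ λ s → 0ℚ < s × s < r × y < s ^ n
^-shrink zero 0<r y<1 = let (s , 0<s , s<r) = <-dense 0<r in s , 0<s , s<r , y<1
^-shrink {r} {y} (suc n) 0<r y<rrⁿ
  with *-shrink 0<r (^-pos n 0<r) y<rrⁿ
... | s , 0<s , s<r , y<srⁿ
  with *-shrink (^-pos n 0<r) 0<s (subst (y <_) (*-comm s (r ^ n)) y<srⁿ)
... | z , 0<z , z<rⁿ , y<zs with ^-shrink n 0<r z<rⁿ | subst (y <_) (*-comm z s) y<zs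
... | t , 0<t , t<r , z<tⁿ | y<sz with ≤-total s t
... | inj₁ s≤t = t , 0<t , t<r ,
  <-≤-trans y<sz (≤-trans (*-monoʳ-≤ (<⇒≤ 0<s) (<⇒≤ z<tⁿ))
                          (*-monoˡ-≤ (^-nonneg n (<⇒≤ 0<t)) s≤t))
... | inj₂ t≤s = s , 0<s , s<r ,
  <-≤-trans y<sz (*-monoʳ-≤ (<⇒≤ 0<s) (≤-trans (<⇒≤ z<tⁿ) (^-mono-≤ n (<⇒≤ 0<t) t≤s)))

^-grow : ∀ {r y} n → 0ℚ ≤ r → r ^ n < y → ∃ λ s → r < s × s ^ n < y
^-grow {r} zero 0≤r 1<y = r + 1ℚ , p<p+1 r , 1<y
^-grow {r} {y} (suc n) 0≤r rrⁿ<y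
  with *-grow (^-nonneg n 0≤r) rrⁿ<y
... | s , r<s , srⁿ<y with ≤-<-trans 0≤r r<s
... | 0<s with *-grow (<⇒≤ 0<s) (subst (_< y) (*-comm s (r ^ n)) srⁿ<y)
... | z , rⁿ<z , zs<y with ^-grow n 0≤r rⁿ<z | subst (_< y) (*-comm z s) zs<y
... | t , r<t , tⁿ<z | sz<y with ≤-total s t | ≤-<-trans 0≤r r<t
... | inj₁ s≤t | 0<t = s , r<s ,
  ≤-<-trans (*-monoʳ-≤ (<⇒≤ 0<s) (≤-trans (^-mono-≤ n (<⇒≤ 0<s) s≤t) (<⇒≤ tⁿ<z))) sz<y
... | inj₂ t≤s | 0<t = t , r<t ,
  ≤-<-trans (≤-trans (*-monoˡ-≤ (^-nonneg n (<⇒≤ 0<t)) t≤s)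
                     (*-monoʳ-≤ (<⇒≤ 0<s) (<⇒≤ tⁿ<z))) sz<y

½^≤1 : ∀ n → ½ ^ n ≤ 1ℚ
½^≤1 zero    = ≤-refl
½^≤1 (suc n) = ≤-trans (*-monoʳ-≤ (from-yes (0ℚ ≤? ½)) (½^≤1 n)) (from-yes (½ * 1ℚ ≤? 1ℚ))

1<2^ : ∀ n .{{_ : ℕ.NonZero n}} → 1ℚ < (1ℚ + 1ℚ) ^ n
1<2^ n = subst (_< (1ℚ + 1ℚ) ^ n) (1^ n)
  (^-mono-< n (from-yes (0ℚ ≤? 1ℚ)) (from-yes (1ℚ <? 1ℚ + 1ℚ)))
  where
  1^ : ∀ n → 1ℚ ^ n ≡ 1ℚ
  1^ zero    = refl
  1^ (suc n) = trans (*-identityˡ (1ℚ ^ n)) (1^ n)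

-- The b-th root of c (of 0 if c is negative).
root : (b : ℕ) .{{_ : ℕ.NonZero b}} (c : ℚ) → c ≤ 1ℚ → ℝ
root b c c≤1 = record
  { L           = λ r → r < 0ℚ ⊎ r ^ b < c
  ; U           = λ r → 0ℚ < r × c < r ^ b
  ; L-inhabited = - 1ℚ , inj₁ (from-yes (- 1ℚ <? 0ℚ))
  ; U-inhabited = 1ℚ + 1ℚ , from-yes (0ℚ <? 1ℚ + 1ℚ) , ≤-<-trans c≤1 (1<2^ b)
  ; L-down      = down
  ; L-open      = open-L
  ; U-up        = up
  ; U-open      = open-U
  ; disjoint    = disj
  ; located     = loc
  }
  where
  down : ∀ {p r} → p < r → r < 0ℚ ⊎ r ^ b < c → p < 0ℚ ⊎ p ^ b < c
  down p<r (inj₁ r<0) = inj₁ (<-trans p<r r<0)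
  down {p} p<r (inj₂ rᵇ<c) with p <? 0ℚ
  ... | yes p<0 = inj₁ p<0
  ... | no  p≮0 = inj₂ (<-trans (^-mono-< b (≮⇒≥ p≮0) p<r) rᵇ<c)

  open-L : ∀ {p} → p < 0ℚ ⊎ p ^ b < c → ∃ λ r → p < r × (r < 0ℚ ⊎ r ^ b < c)
  open-L (inj₁ p<0) = let (r , p<r , r<0) = <-dense p<0 in r , p<r , inj₁ r<0
  open-L {p} (inj₂ pᵇ<c) with p <? 0ℚ
  ... | yes p<0 = let (r , p<r , r<0) = <-dense p<0 in r , p<r , inj₁ r<0
  ... | no  p≮0 = let (r , p<r , rᵇ<c) = ^-grow b (≮⇒≥ p≮0) pᵇ<c in r , p<r , inj₂ rᵇ<c

  up : ∀ {p r} → p < r → 0ℚ < p × c < p ^ b → 0ℚ < r × c < r ^ b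
  up p<r (0<p , c<pᵇ) = <-trans 0<p p<r , <-trans c<pᵇ (^-mono-< b (<⇒≤ 0<p) p<r)

  open-U : ∀ {r} → 0ℚ < r × c < r ^ b → ∃ λ p → p < r × 0ℚ < p × c < p ^ b
  open-U (0<r , c<rᵇ) =
    let (p , 0<p , p<r , c<pᵇ) = ^-shrink b 0<r c<rᵇ in p , p<r , 0<p , c<pᵇ

  disj : ∀ {r} → r < 0ℚ ⊎ r ^ b < c → 0ℚ < r × c < r ^ b → ⊥
  disj (inj₁ r<0)  (0<r , _)  = <-asym r<0 0<r
  disj (inj₂ rᵇ<c) (_ , c<rᵇ) = <-asym rᵇ<c c<rᵇ

  loc : ∀ {p r} → p < r → (p < 0ℚ ⊎ p ^ b < c) ⊎ (0ℚ < r × c < r ^ b)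
  loc {p} p<r with p <? 0ℚ
  ... | yes p<0 = inj₁ (inj₁ p<0)
  ... | no  p≮0 with p ^ b <? c
  ...   | yes pᵇ<c = inj₁ (inj₂ pᵇ<c)
  ...   | no  pᵇ≮c = inj₂ (≤-<-trans (≮⇒≥ p≮0) p<r ,
                           ≤-<-trans (≮⇒≥ pᵇ≮c) (^-mono-< b (≮⇒≥ p≮0) p<r))

infix 8 2^-_

-- For q = a/b this is the b-th root of (1/2)^a.
2^-_ : (q : ℚ) .{{_ : NonNegative q}} → ℝ
2^- q = root (↧ₙ q) (½ ^ ℤ.∣ ↥ q ∣) (½^≤1 ℤ.∣ ↥ q ∣)

½^-archimedean : ∀ {s} → 0ℚ < s → ∃ λ n → ½ ^ n < s
½^-archimedean {s} 0<s = arch s {{positive 0<s}}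
  where
  1/[1+_] : ℕ → ℚ
  1/[1+ n ] = mkℚ (+ 1) n (Coprimality.1-coprimeTo (suc n))

  ½^≤1/[1+n] : ∀ n → ½ ^ n ≤ 1/[1+ n ]
  ½^≤1/[1+n] zero    = ≤-refl
  ½^≤1/[1+n] (suc n) = ≤-trans (*-monoʳ-≤ (from-yes (0ℚ ≤? ½)) (½^≤1/[1+n] n))
    (toℚᵘ-cancel-≤ (ℚᵘₚ.≤-respˡ-≃ (ℚᵘₚ.≃-sym (toℚᵘ-homo-* ½ 1/[1+ n ]))
      (ℚᵘ.*≤* (ℤ.+≤+ (ℕₚ.+-monoˡ-≤ 0 {suc (suc n)} {2 ℕ.* suc n}
        (ℕ.s≤s (ℕₚ.≤-trans (ℕₚ.m≤n+m (suc n) n) (ℕₚ.+-monoʳ-≤ n (ℕₚ.m≤m+n (suc n) 0)))))))))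

  arch : ∀ s → .{{Positive s}} → ∃ λ n → ½ ^ n < s
  arch s@(mkℚ +[1+ m ] n _) = suc n , ≤-<-trans (½^≤1/[1+n] (suc n))
    (*<* (ℤ.+<+ (ℕₚ.<-≤-trans (ℕₚ.n<1+n _) (ℕₚ.≤-trans
      (ℕₚ.≤-reflexive (cong suc (ℕₚ.+-identityʳ (suc n))))
      (ℕₚ.m≤m+n (suc (suc n)) (m ℕ.* suc (suc n)))))))

½^-antimono-≤ : ∀ {m n} → m ℕ.≤ n → ½ ^ n ≤ ½ ^ m
½^-antimono-≤ {n = n} ℕ.z≤n = ½^≤1 n
½^-antimono-≤ (ℕ.s≤s m≤n)   = *-monoʳ-≤ (from-yes (0ℚ ≤? ½)) (½^-antimono-≤ m≤n)

fromℕ : ℕ → ℚ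
fromℕ m = mkℚ (+ m) 0 (Coprimality.sym (Coprimality.1-coprimeTo m))

2^-<-from-ℕ : ∀ m q .{{_ : NonNegative q}} {s} →
              ½ ^ m < s → fromℕ m ≤ q → ℝ.U (2^- q) s
2^-<-from-ℕ m q@(mkℚ (+ a) b-1 _) {s} ½ᵐ<s (*≤* m≤q) =
  ≤-<-trans 0≤½ᵐ ½ᵐ<s ,
  ≤-<-trans (≤-trans (½^-antimono-≤ mb≤a) (≤-reflexive (sym (^-assocʳ ½ m b))))
            (^-mono-< b 0≤½ᵐ ½ᵐ<s)
  where
  b = suc b-1
  0≤½ᵐ : 0ℚ ≤ ½ ^ m
  0≤½ᵐ = ^-nonneg m (from-yes (0ℚ ≤? ½))
  mb≤a : m ℕ.* b ℕ.≤ a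
  mb≤a = ℤₚ.drop‿+≤+ (subst₂ ℤ._≤_ (sym (ℤₚ.pos-* m b)) (ℤₚ.*-identityʳ (+ a)) m≤q)

record Z : Set where
  field
    seq        : ℕ → ℚ
    nonneg     : ∀ n → NonNegative (seq n)
    increasing : ∀ n → seq n < seq (suc n)
    unbounded  : ∀ M → ∃ λ N → ∀ n → N ℕ.≤ n → M < seq n

open Z public using (seq)

infix 4 _≈_

_≈_ : Rel Z 0ℓ
Q ≈ Q′ = ∀ n → seq Q n ≡ seq Q′ n

FirstDifference : Z → Z → ℕ → Set
FirstDifference Q Q′ k = seq Q k ≢ seq Q′ k × (∀ j → j ℕ.< k → seq Q j ≡ seq Q′ j)

min-nonneg : ∀ Q Q′ k → NonNegative (seq Q k ⊓ seq Q′ k)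
min-nonneg Q Q′ k with ⊓-sel (seq Q k) (seq Q′ k)
... | inj₁ eq = subst NonNegative (sym eq) (Z.nonneg Q k)
... | inj₂ eq = subst NonNegative (sym eq) (Z.nonneg Q′ k)

2^-min : Z → Z → ℕ → ℝ
2^-min Q Q′ k = (2^- (seq Q k ⊓ seq Q′ k)) {{min-nonneg Q Q′ k}}

FirstDifference-unique : ∀ Q Q′ {k l} →
  FirstDifference Q Q′ k → FirstDifference Q Q′ l → k ≡ l
FirstDifference-unique Q Q′ {k} {l} (k≢ , <k≡) (l≢ , <l≡) with ℕₚ.<-cmp k l
... | tri< k<l _ _ = ⊥-elim (k≢ (<l≡ k k<l))
... | tri≈ _ k≡l _ = k≡l
... | tri> _ _ l<k = ⊥-elim (l≢ (<k≡ l l<k))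

search : ∀ Q Q′ N →
  ∃ (FirstDifference Q Q′) ⊎ (∀ j → j ℕ.< N → seq Q j ≡ seq Q′ j)
search Q Q′ zero    = inj₂ (λ _ ())
search Q Q′ (suc N) with search Q Q′ N
... | inj₁ found = inj₁ found
... | inj₂ agree with seq Q N ≟ seq Q′ N
...   | no  differ = inj₁ (N , differ , agree)
...   | yes same   = inj₂ agree′
  where
  agree′ : ∀ j → j ℕ.< suc N → seq Q j ≡ seq Q′ j
  agree′ j (ℕ.s≤s j≤N) with ℕₚ.m≤n⇒m<n∨m≡n j≤N
  ... | inj₁ j<N  = agree j j<N
  ... | inj₂ refl = same

differ-or-close : ∀ Q Q′ {s} → 0ℚ < s →
  ∃ (FirstDifference Q Q′) ⊎ (∀ k → FirstDifference Q Q′ k → ℝ.U (2^-min Q Q′ k) s)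
differ-or-close Q Q′ {s} 0<s with ½^-archimedean 0<s
... | m , ½ᵐ<s with Z.unbounded Q (fromℕ m) | Z.unbounded Q′ (fromℕ m)
... | N , m<Q | N′ , m<Q′ with search Q Q′ (N ℕ.⊔ N′)
... | inj₁ found = inj₁ found
... | inj₂ agree = inj₂ close
  where
  close : ∀ k → FirstDifference Q Q′ k → ℝ.U (2^-min Q Q′ k) s
  close k (k≢ , _) with ℕₚ.<-≤-connex k (N ℕ.⊔ N′)
  ... | inj₁ k<N = ⊥-elim (k≢ (agree k k<N))
  ... | inj₂ N≤k = 2^-<-from-ℕ m _ {{min-nonneg Q Q′ k}} ½ᵐ<s
    (⊓-glb (<⇒≤ (m<Q k (ℕₚ.≤-trans (ℕₚ.m≤m⊔n N N′) N≤k)))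
           (<⇒≤ (m<Q′ k (ℕₚ.≤-trans (ℕₚ.m≤n⊔m N N′) N≤k))))

-- The case distinction Q ≈ Q′ is not decidable, so the cut is given
-- uniformly; d-same and d-different below are the two defining cases.
d : Z → Z → ℝ
d Q Q′ = record
  { L           = Lᵈ
  ; U           = Uᵈ
  ; L-inhabited = - 1ℚ , inj₁ (from-yes (- 1ℚ <? 0ℚ))
  ; U-inhabited = 1ℚ + 1ℚ , from-yes (0ℚ <? 1ℚ + 1ℚ) ,
                  λ k _ → ℝ.U-inhabited (2^-min Q Q′ k) .proj₂
  ; L-down      = λ { p<q (inj₁ q<0) → inj₁ (<-trans p<q q<0)
                    ; p<q (inj₂ (k , fd , q∈)) →
                        inj₂ (k , fd , ℝ.L-down (2^-min Q Q′ k) p<q q∈) }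
  ; L-open      = open-L
  ; U-up        = λ p<q (0<p , p∈) → <-trans 0<p p<q ,
                    λ k fd → ℝ.U-up (2^-min Q Q′ k) p<q (p∈ k fd)
  ; U-open      = open-U
  ; disjoint    = λ { (inj₁ q<0) (0<q , _) → <-asym q<0 0<q
                    ; (inj₂ (k , fd , q∈L)) (_ , q∈U) →
                        ℝ.disjoint (2^-min Q Q′ k) q∈L (q∈U k fd) }
  ; located     = loc
  }
  where
  Lᵈ Uᵈ : Pred ℚ 0ℓ
  Lᵈ r = r < 0ℚ ⊎ ∃ λ k → FirstDifference Q Q′ k × ℝ.L (2^-min Q Q′ k) r
  Uᵈ r = 0ℚ < r × ∀ k → FirstDifference Q Q′ k → ℝ.U (2^-min Q Q′ k) r

  positive-U : ∀ k r → ℝ.U (2^-min Q Q′ k) r → 0ℚ < r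
  positive-U k r = proj₁

  only : ∀ k r → FirstDifference Q Q′ k → ℝ.U (2^-min Q Q′ k) r →
         ∀ l → FirstDifference Q Q′ l → ℝ.U (2^-min Q Q′ l) r
  only k r fd r∈ l fd′ =
    subst (λ j → ℝ.U (2^-min Q Q′ j) r) (FirstDifference-unique Q Q′ fd fd′) r∈

  open-L : ∀ {p} → Lᵈ p → ∃ λ q → p < q × Lᵈ q
  open-L (inj₁ p<0) = let (q , p<q , q<0) = <-dense p<0 in q , p<q , inj₁ q<0
  open-L (inj₂ (k , fd , p∈)) =
    let (q , p<q , q∈) = ℝ.L-open (2^-min Q Q′ k) p∈ in q , p<q , inj₂ (k , fd , q∈)

  open-U : ∀ {q} → Uᵈ q → ∃ λ p → p < q × Uᵈ p
  open-U {q} (0<q , q∈) = let (s , 0<s , s<q) = <-dense 0<q in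
                          from s 0<s s<q (differ-or-close Q Q′ 0<s)
    where
    from : ∀ s → 0ℚ < s → s < q → ∃ (FirstDifference Q Q′) ⊎
             (∀ k → FirstDifference Q Q′ k → ℝ.U (2^-min Q Q′ k) s) →
           ∃ λ p → p < q × Uᵈ p
    from s 0<s s<q (inj₂ close)    = s , s<q , 0<s , close
    from s 0<s s<q (inj₁ (k , fd)) =
      let (p , p<q , p∈) = ℝ.U-open (2^-min Q Q′ k) (q∈ k fd) in
      p , p<q , positive-U k p p∈ , only k p fd p∈

  loc : ∀ {p q} → p < q → Lᵈ p ⊎ Uᵈ q
  loc {p} {q} p<q = sign (p <? 0ℚ)
    where
    differ : 0ℚ < q → ∃ (FirstDifference Q Q′) ⊎
               (∀ k → FirstDifference Q Q′ k → ℝ.U (2^-min Q Q′ k) q) →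
             Lᵈ p ⊎ Uᵈ q
    differ 0<q (inj₂ close)    = inj₂ (0<q , close)
    differ 0<q (inj₁ (k , fd)) =
      Sum.map (λ p∈ → inj₂ (k , fd , p∈)) (λ q∈ → 0<q , only k q fd q∈)
              (ℝ.located (2^-min Q Q′ k) p<q)

    sign : Dec (p < 0ℚ) → Lᵈ p ⊎ Uᵈ q
    sign (yes p<0) = inj₁ (inj₁ p<0)
    sign (no  p≮0) = let 0<q = ≤-<-trans (≮⇒≥ p≮0) p<q in
                     differ 0<q (differ-or-close Q Q′ 0<q)

d-same : ∀ {Q Q′} → Q ≈ Q′ → d Q Q′ ≃ℝ 0ℝ
d-same Q≈Q′ =
  (λ r → mk⇔ (λ { (inj₁ r<0) → r<0 ; (inj₂ (k , (k≢ , _) , _)) → ⊥-elim (k≢ (Q≈Q′ k)) }) inj₁) ,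
  (λ r → mk⇔ proj₁ (λ 0<r → 0<r , λ k (k≢ , _) → ⊥-elim (k≢ (Q≈Q′ k))))

d-different : ∀ {Q Q′ k} → FirstDifference Q Q′ k → d Q Q′ ≃ℝ 2^-min Q Q′ k
d-different {Q} {Q′} {k} fd =
  (λ r → mk⇔ (λ { (inj₁ r<0) → inj₁ r<0
                ; (inj₂ (l , fd′ , r∈)) →
                    subst (λ j → ℝ.L (2^-min Q Q′ j) r) (FirstDifference-unique Q Q′ fd′ fd) r∈ })
             (λ r∈ → inj₂ (k , fd , r∈))) ,
  (λ r → mk⇔ (λ (_ , r∈) → r∈ k fd)
             (λ r∈ → proj₁ r∈ , λ l fd′ →
                subst (λ j → ℝ.U (2^-min Q Q′ j) r) (FirstDifference-unique Q Q′ fd fd′) r∈))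

-- X is a set with equality _≈_ and metric d.
module FirstReturn {X : Set} (_≈_ : Rel X 0ℓ) (d : X → X → ℝ) where

  IsClosed : Pred X 0ℓ → Set
  IsClosed F = ∀ x → (∀ ε → 0ℚ < ε → ∃ λ y → F y × d x y <ℝ fromℚ ε) → F x

  IsDense : (ℕ → X) → Set
  IsDense D = ∀ x ε → 0ℚ < ε → ∃ λ p → d x (D p) <ℝ fromℚ ε

  -- s is the route to x based on D.
  record IsRoute (D : ℕ → X) (x : X) (s : ℕ → X) : Set where
    field
      start : s 0 ≈ D 0
      stop  : ∀ n → x ≈ s n → s (suc n) ≈ s n
      step  : ∀ n → ¬ x ≈ s n → ∃ λ p →
              s (suc n) ≈ D p × d x (D p) <ℝ d x (s n) ×
              (∀ p′ → d x (D p′) <ℝ d x (s n) → p ℕ.≤ p′)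

  -- A function f : X → Y is given by its graph, so that characteristic
  -- functions of undecidable subsets are covered.  Y is discrete:
  -- convergence to y means being eventually equal to y.
  FirstReturnRecoverable : {Y : Set} → (X → Y → Set) → Set
  FirstReturnRecoverable f = ∃ λ D → IsDense D × (∀ x → ∃ λ s → IsRoute D x s ×
    (∀ y → f x y → ∃ λ N → ∀ n → N ℕ.≤ n → f (s n) y))

open FirstReturn _≈_ d public

characteristic : {X : Set} → Pred X 0ℓ → X → Fin 2 → Set
characteristic F x 0F = ¬ F x
characteristic F x 1F = F x

{-# OPTIONS --safe #-}

-- The closed set consists of the Q with q_n < n + 1 for all n.  Given a dense
-- sequence D, choose x_n in [n, n+1) recursively: by density some D p agrees
-- with x below n and takes the value n + 1 at n, hence lies outside the set, and
-- x_n is taken larger than the n-th term of each of the finitely many earlier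
-- points of D whose n-th term is less than n + 1.  Then D p is at distance
-- 2^(-x_n) from x, while every point of the set listed before D p is strictly
-- farther away.  A route to x whose points eventually stay in the set could
-- never pass D p, yet its indices increase strictly.

module Submission where

open import Defs
open import Algebra.Bundles using (CommutativeRing)
import Algebra.Properties.CommutativeSemiring.Exp as CommutativeExp
open import Data.Empty using (⊥-elim)
open import Data.Fin.Patterns using (1F)
import Data.Integer.Base as ℤ
import Data.Integer.Properties as ℤₚ
open import Data.Nat.Base as ℕ using (ℕ; zero; suc)
import Data.Nat.Properties as ℕₚ
open import Data.Product using (∃; _×_; _,_; proj₁; proj₂)
open import Data.Rational.Base
open import Data.Rational.Properties
open import Data.Sum.Base using (_⊎_; inj₁; inj₂)
open import Function.Bundles using (module Equivalence)
open import Level using (0ℓ)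
open import Relation.Binary.Definitions using (_Respects_; tri<; tri≈; tri>)
open import Relation.Binary.PropositionalEquality
open import Relation.Nullary using (¬_; yes; no)
open import Relation.Nullary.Decidable using (from-yes)
open import Relation.Unary using (Pred; Decidable)

open CommutativeExp (CommutativeRing.commutativeSemiring +-*-commutativeRing)
  using (^-distrib-*)

-- The strict order on cuts.

<ℝ-trans : ∀ {x y z} → x <ℝ y → y <ℝ z → x <ℝ z
<ℝ-trans {y = y} {z} (p , p∈Ux , p∈Ly) (q , q∈Uy , q∈Lz) with <-cmp p q
... | tri< p<q _ _  = p , p∈Ux , ℝ.L-down z p<q q∈Lz
... | tri≈ _ refl _ = p , p∈Ux , q∈Lz
... | tri> _ _ q<p  = ⊥-elim (ℝ.disjoint y (ℝ.L-down y q<p p∈Ly) q∈Uy)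

<ℝ-irrefl : ∀ {x} → ¬ x <ℝ x
<ℝ-irrefl {x} (q , q∈U , q∈L) = ℝ.disjoint x q∈L q∈U

-- Powers of rationals and approximate roots.

1^n≡1 : ∀ n → 1ℚ ^ n ≡ 1ℚ
1^n≡1 zero    = refl
1^n≡1 (suc n) = trans (*-identityˡ (1ℚ ^ n)) (1^n≡1 n)

^-cancel-< : ∀ {r s} n → 0ℚ ≤ s → r ^ n < s ^ n → r < s
^-cancel-< {r} {s} n 0≤s rⁿ<sⁿ with r <? s
... | yes r<s = r<s
... | no  r≮s = ⊥-elim (<-irrefl refl (<-≤-trans rⁿ<sⁿ (^-mono-≤ n 0≤s (≮⇒≥ r≮s))))

0≤½^ : ∀ n → 0ℚ ≤ ½ ^ n
0≤½^ n = ^-nonneg n (from-yes (0ℚ ≤? ½))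

½^-antimono-< : ∀ {m n} → m ℕ.< n → ½ ^ n < ½ ^ m
½^-antimono-< {m} m<n = ≤-<-trans (½^-antimono-≤ m<n)
  (subst (½ * ½ ^ m <_) (*-identityˡ (½ ^ m))
         (*-monoˡ-< (^-pos m (from-yes (0ℚ <? ½))) (from-yes (½ <? 1ℚ))))

p≤p+½ⁿ : ∀ p n → p ≤ p + ½ ^ n
p≤p+½ⁿ p n = subst (_≤ p + ½ ^ n) (+-identityʳ p) (+-monoʳ-≤ p (0≤½^ n))

-- Interval halving: the midpoint replaces the end at which `P` has the same truth value.
bisect : ∀ {P : Pred ℚ 0ℓ} → Decidable P → ∀ {r} → P r → ¬ P (r + 1ℚ) → ∀ n →
         ∃ λ s → r ≤ s × P s × ¬ P (s + ½ ^ n)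
bisect P? Pr ¬Pr+1 zero = _ , ≤-refl , Pr , ¬Pr+1
bisect {P} P? {r} Pr ¬Pr+1 (suc n) with bisect P? Pr ¬Pr+1 n
... | s , r≤s , Ps , ¬Ps+ with P? (s + ½ ^ suc n)
...   | no  ¬Pmid = s , r≤s , Ps , ¬Pmid
...   | yes Pmid  = s + ½ ^ suc n , ≤-trans r≤s (p≤p+½ⁿ s (suc n)) , Pmid ,
                    λ Ptop → ¬Ps+ (subst P halves Ptop)
  where
  halves : s + ½ ^ suc n + ½ ^ suc n ≡ s + ½ ^ n
  halves = begin
    s + ½ * ½ ^ n + ½ * ½ ^ n    ≡⟨ +-assoc s _ _ ⟩
    s + (½ * ½ ^ n + ½ * ½ ^ n)  ≡⟨ cong (s +_) (sym (*-distribʳ-+ (½ ^ n) ½ ½)) ⟩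
    s + 1ℚ * ½ ^ n               ≡⟨ cong (s +_) (*-identityˡ (½ ^ n)) ⟩
    s + ½ ^ n                    ∎
    where open ≡-Reasoning

-‿pos : ∀ {p q} → p < q → 0ℚ < q - p
-‿pos {p} {q} p<q = subst (_< q - p) (+-inverseʳ p) (+-monoˡ-< (- p) p<q)

*-pos : ∀ {p q} → 0ℚ < p → 0ℚ < q → 0ℚ < p * q
*-pos {p} {q} 0<p 0<q = subst (_< p * q) (*-zeroˡ q) (*-monoˡ-< 0<q 0<p)

1≤^ : ∀ {r} n → 1ℚ ≤ r → 1ℚ ≤ r ^ n
1≤^ {r} n 1≤r = subst (_≤ r ^ n) (1^n≡1 n) (^-mono-≤ n (from-yes (0ℚ ≤? 1ℚ)) 1≤r)

1≤p+1 : ∀ {p} → 0ℚ ≤ p → 1ℚ ≤ p + 1ℚ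
1≤p+1 {p} 0≤p = subst (_≤ p + 1ℚ) (+-identityˡ 1ℚ) (+-monoˡ-≤ 1ℚ 0≤p)

-- Turns an additive error into a relative one: `σ * ε ≤ ε ≤ (1ℚ - σ) * r`, which is what `σ * r`
-- lacks to reach `r`.
scale-≤ : ∀ {σ r l ε} → 0ℚ ≤ σ → σ < 1ℚ → 0ℚ ≤ ε → l ≤ r → ε ≤ (1ℚ - σ) * l →
          σ * (r + ε) ≤ r
scale-≤ {σ} {r} {l} {ε} 0≤σ σ<1 0≤ε l≤r ε≤ = begin
  σ * (r + ε)           ≡⟨ *-distribˡ-+ σ r ε ⟩
  σ * r + σ * ε         ≤⟨ +-monoʳ-≤ (σ * r) (*-monoˡ-≤ 0≤ε (<⇒≤ σ<1)) ⟩
  σ * r + 1ℚ * ε        ≡⟨ cong (σ * r +_) (*-identityˡ ε) ⟩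
  σ * r + ε             ≤⟨ +-monoʳ-≤ (σ * r) ε≤ ⟩
  σ * r + (1ℚ - σ) * l  ≤⟨ +-monoʳ-≤ (σ * r) (*-monoʳ-≤ (<⇒≤ (-‿pos σ<1)) l≤r) ⟩
  σ * r + (1ℚ - σ) * r  ≡⟨ sym (*-distribʳ-+ r σ (1ℚ - σ)) ⟩
  (σ + (1ℚ - σ)) * r    ≡⟨ cong (_* r) (trans (+-comm σ (1ℚ - σ)) (p-q+q≡p 1ℚ σ)) ⟩
  1ℚ * r                ≡⟨ *-identityˡ r ⟩
  r                     ∎
  where
  open ≤-Reasoning
  p-q+q≡p : ∀ p q → p - q + q ≡ p
  p-q+q≡p p q = trans (+-assoc p (- q) q) (trans (cong (p +_) (+-inverseˡ q)) (+-identityʳ p))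

-- Bisection from `l` encloses the `b`-th root of `c` between `r` and `h = r + ½ ^ n`. Since `l`
-- keeps `r` away from 0, a large `n` gives `σ * h ≤ r`, and powers respect products.
approximate-root : ∀ b {σ l c} → 0ℚ < σ → σ < 1ℚ → 0ℚ < l → l ^ b < c → c ≤ 1ℚ →
                   ∃ λ r → 0ℚ < r × σ ^ b * c ≤ r ^ b × r ^ b < c
approximate-root b {σ} {l} {c} 0<σ σ<1 0<l lᵇ<c c≤1 =
  let (n , ½ⁿ<) = ½^-archimedean (*-pos (-‿pos σ<1) 0<l)
      (r , l≤r , rᵇ<c , h≮c) = bisect (λ r → r ^ b <? c) lᵇ<c too-big n
  in  r , <-≤-trans 0<l l≤r ,
      lower (≤-trans (≤-trans (<⇒≤ 0<l) l≤r) (p≤p+½ⁿ r n)) (≮⇒≥ h≮c)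
            (scale-≤ (<⇒≤ 0<σ) σ<1 (0≤½^ n) l≤r (<⇒≤ ½ⁿ<)) ,
      rᵇ<c
  where
  -- An interval of length 1 suffices at the start because `c ≤ 1ℚ ≤ (l + 1ℚ) ^ b`.
  too-big : ¬ (l + 1ℚ) ^ b < c
  too-big lt = <-irrefl refl (<-≤-trans lt (≤-trans c≤1 (1≤^ b (1≤p+1 (<⇒≤ 0<l)))))
  lower : ∀ {r h} → 0ℚ ≤ h → c ≤ h ^ b → σ * h ≤ r → σ ^ b * c ≤ r ^ b
  lower {r} {h} 0≤h c≤hᵇ σh≤r = begin
    σ ^ b * c      ≤⟨ *-monoʳ-≤ (^-nonneg b (<⇒≤ 0<σ)) c≤hᵇ ⟩
    σ ^ b * h ^ b  ≡⟨ sym (^-distrib-* σ h b) ⟩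
    (σ * h) ^ b    ≤⟨ ^-mono-≤ b 0≤σh σh≤r ⟩
    r ^ b          ∎
    where
    open ≤-Reasoning
    0≤σh : 0ℚ ≤ σ * h
    0≤σh = subst (_≤ σ * h) (*-zeroʳ σ) (*-monoʳ-≤ (<⇒≤ 0<σ) 0≤h)

-- For `σ` close enough to 1 still `c < σ ^ b * c′`, so a root of `c′` approximated from below
-- within the factor `σ` has its power in the gap.
^-dense : ∀ b .{{_ : ℕ.NonZero b}} {c c′} → 0ℚ ≤ c → c < c′ → c′ ≤ 1ℚ →
          ∃ λ r → 0ℚ < r × c < r ^ b × r ^ b < c′
^-dense b {c} {c′} 0≤c c<c′ c′≤1 =
  let (τ , 0<τ , τ<1 , c<τc′) = *-shrink 0<1 0<c′ (subst (c <_) (sym (*-identityˡ c′)) c<c′)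
      (σ , 0<σ , σ<1 , τ<σᵇ)  = ^-shrink b 0<1 (subst (τ <_) (sym (1^n≡1 b)) τ<1)
      (l , 0<l , lᵇ<c′)       = ^-grow b ≤-refl (subst (_< c′) (sym (0^n≡0 b)) 0<c′)
      (r , 0<r , lower , rᵇ<c′) = approximate-root b 0<σ σ<1 0<l lᵇ<c′ c′≤1
  in  r , 0<r , <-≤-trans c<τc′ (≤-trans (*-monoˡ-≤ (<⇒≤ 0<c′) (<⇒≤ τ<σᵇ)) lower) , rᵇ<c′
  where
  0<1 : 0ℚ < 1ℚ
  0<1 = from-yes (0ℚ <? 1ℚ)
  0<c′ : 0ℚ < c′
  0<c′ = ≤-<-trans 0≤c c<c′
  0^n≡0 : ∀ n .{{_ : ℕ.NonZero n}} → 0ℚ ^ n ≡ 0ℚ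
  0^n≡0 (suc n) = *-zeroˡ (0ℚ ^ n)

-- Comparison of the cuts `2^- q`.

^-comm : ∀ r m n → (r ^ m) ^ n ≡ (r ^ n) ^ m
^-comm r m n = begin
  (r ^ m) ^ n    ≡⟨ ^-assocʳ r m n ⟩
  r ^ (m ℕ.* n)  ≡⟨ cong (r ^_) (ℕₚ.*-comm m n) ⟩
  r ^ (n ℕ.* m)  ≡⟨ sym (^-assocʳ r n m) ⟩
  (r ^ n) ^ m    ∎
  where open ≡-Reasoning

-- Take `c` slightly above `x` with `c ^ b < y ^ b′`, and `r ^ b′` between `x` and `c`. Then
-- `(r ^ b) ^ b′ = (r ^ b′) ^ b < y ^ b′`, and the exponent `b′` cancels.
roots-separated : ∀ b b′ .{{_ : ℕ.NonZero b}} .{{_ : ℕ.NonZero b′}} {x y} →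
  0ℚ ≤ x → 0ℚ ≤ y → y ≤ 1ℚ → x ^ b < y ^ b′ →
  ∃ λ r → 0ℚ < r × x < r ^ b′ × r ^ b < y
roots-separated b b′ {x} {y} 0≤x 0≤y y≤1 xᵇ<yᵇ′ =
  let (c , x<c , cᵇ<yᵇ′) = ^-grow b 0≤x xᵇ<yᵇ′
      (r , 0<r , x<rᵇ′ , rᵇ′<c) = ^-dense b′ 0≤x x<c (c≤1 cᵇ<yᵇ′)
  in  r , 0<r , x<rᵇ′ ,
      ^-cancel-< b′ 0≤y (subst (_< y ^ b′) (^-comm r b′ b)
        (<-trans (^-mono-< b (^-nonneg b′ (<⇒≤ 0<r)) rᵇ′<c) cᵇ<yᵇ′))
  where
  c≤1 : ∀ {c} → c ^ b < y ^ b′ → c ≤ 1ℚ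
  c≤1 {c} cᵇ<yᵇ′ = <⇒≤ (^-cancel-< b (from-yes (0ℚ ≤? 1ℚ)) (<-≤-trans cᵇ<yᵇ′
    (≤-trans (^-mono-≤ b′ 0≤y y≤1) (≤-reflexive (trans (1^n≡1 b′) (sym (1^n≡1 b)))))))

-- Raised to the power `b * b′`, the two roots become powers of `½` with exponents `a * b′` and
-- `a′ * b`.
½-roots-separated : ∀ a b a′ b′ .{{_ : ℕ.NonZero b}} .{{_ : ℕ.NonZero b′}} →
  a ℕ.* b′ ℕ.< a′ ℕ.* b → ∃ λ r → 0ℚ < r × ½ ^ a′ < r ^ b′ × r ^ b < ½ ^ a
½-roots-separated a b a′ b′ ab′<a′b = roots-separated b b′ (0≤½^ a′) (0≤½^ a) (½^≤1 a)
  (subst₂ _<_ (sym (^-assocʳ ½ a′ b)) (sym (^-assocʳ ½ a b′)) (½^-antimono-< ab′<a′b))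

2^-antimono-< : ∀ p q .{{_ : NonNegative p}} .{{_ : NonNegative q}} →
                p < q → 2^- q <ℝ 2^- p
2^-antimono-< p@(mkℚ (ℤ.+ a) b-1 _) q@(mkℚ (ℤ.+ a′) b′-1 _) (*<* ab′<a′b) =
  cut (½-roots-separated a (suc b-1) a′ (suc b′-1) (ℤₚ.drop‿+<+
    (subst₂ ℤ._<_ (sym (ℤₚ.pos-* a (suc b′-1))) (sym (ℤₚ.pos-* a′ (suc b-1))) ab′<a′b)))
  where
  cut : (∃ λ r → 0ℚ < r × ½ ^ a′ < r ^ suc b′-1 × r ^ suc b-1 < ½ ^ a) → 2^- q <ℝ 2^- p
  cut (r , 0<r , ½<r , r<½) = r , (0<r , ½<r) , inj₂ r<½

½-root-≥ : ∀ m a b {r} → a ℕ.≤ m ℕ.* b → 0ℚ ≤ r → ½ ^ a < r ^ b → ½ ^ m < r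
½-root-≥ m a b a≤mb 0≤r ½ᵃ<rᵇ = ^-cancel-< b 0≤r (≤-<-trans
  (≤-trans (≤-reflexive (^-assocʳ ½ m b)) (½^-antimono-≤ a≤mb)) ½ᵃ<rᵇ)

2^-≥½^ : ∀ m q .{{_ : NonNegative q}} {r} → q ≤ fromℕ m → ℝ.U (2^- q) r → ½ ^ m < r
2^-≥½^ m (mkℚ (ℤ.+ a) b-1 _) (*≤* q≤m) (0<r , ½ᵃ<rᵇ) =
  ½-root-≥ m a (suc b-1) (ℤₚ.drop‿+≤+
    (subst₂ ℤ._≤_ (ℤₚ.*-identityʳ (ℤ.+ a)) (sym (ℤₚ.pos-* m (suc b-1))) q≤m))
    (<⇒≤ 0<r) ½ᵃ<rᵇ

-- Natural bounds and finite suprema in the rationals.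

fromℕ-mono-≤ : ∀ {m n} → m ℕ.≤ n → fromℕ m ≤ fromℕ n
fromℕ-mono-≤ m≤n = *≤* (ℤₚ.*-monoʳ-≤-nonNeg (ℤ.+ 1) (ℤ.+≤+ m≤n))

fromℕ-mono-< : ∀ {m n} → m ℕ.< n → fromℕ m < fromℕ n
fromℕ-mono-< m<n = *<* (ℤₚ.*-monoʳ-<-pos (ℤ.+ 1) (ℤ.+<+ m<n))

archimedean : ∀ q → ∃ λ n → q ≤ fromℕ n
archimedean (mkℚ (ℤ.+ a) b-1 _) = a , *≤* (subst₂ ℤ._≤_
  (sym (ℤₚ.*-identityʳ (ℤ.+ a))) (ℤₚ.pos-* a (suc b-1)) (ℤ.+≤+ (ℕₚ.m≤m*n a (suc b-1))))
archimedean (mkℚ ℤ.-[1+ a ] b-1 _) = 0 , *≤* (subst₂ ℤ._≤_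
  (sym (ℤₚ.*-identityʳ ℤ.-[1+ a ])) (ℤₚ.pos-* 0 (suc b-1)) ℤ.-≤+)

-- Values at or above `hi` impose nothing; the maximum of the others and `lo` is below `hi`, and
-- density leaves room above it.
above-finitely-many : ∀ {lo hi} → lo < hi → ∀ (g : ℕ → ℚ) n →
  ∃ λ t → lo ≤ t × t < hi × (∀ i → i ℕ.< n → g i < hi → g i < t)
above-finitely-many {lo} lo<hi g zero = lo , ≤-refl , lo<hi , λ _ ()
above-finitely-many {lo} {hi} lo<hi g (suc n) with above-finitely-many lo<hi g n
... | t , lo≤t , t<hi , g<t with g n <? hi
...   | no gₙ≮hi = t , lo≤t , t<hi , below
  where
  below : ∀ i → i ℕ.< suc n → g i < hi → g i < t
  below i i<1+n gᵢ<hi with ℕₚ.m<1+n⇒m<n∨m≡n i<1+n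
  ... | inj₁ i<n  = g<t i i<n gᵢ<hi
  ... | inj₂ refl = ⊥-elim (gₙ≮hi gᵢ<hi)
...   | yes gₙ<hi =
  let (u , m<u , u<hi) = <-dense {t ⊔ g n} (⊔-lub-< t<hi gₙ<hi)
      t<u = ≤-<-trans (p≤p⊔q t (g n)) m<u
  in  u , ≤-trans lo≤t (<⇒≤ t<u) , u<hi , λ i i<1+n gᵢ<hi → below m<u t<u i i<1+n gᵢ<hi
  where
  ⊔-lub-< : ∀ {p q r} → p < r → q < r → p ⊔ q < r
  ⊔-lub-< {p} {q} p<r q<r with ⊔-sel p q
  ... | inj₁ eq = subst (_< _) (sym eq) p<r
  ... | inj₂ eq = subst (_< _) (sym eq) q<r
  below : ∀ {u} → t ⊔ g n < u → t < u → ∀ i → i ℕ.< suc n → g i < hi → g i < u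
  below m<u t<u i i<1+n gᵢ<hi with ℕₚ.m<1+n⇒m<n∨m≡n i<1+n
  ... | inj₁ i<n  = <-trans (g<t i i<n gᵢ<hi) t<u
  ... | inj₂ refl = ≤-<-trans (p≤q⊔p t (g n)) m<u

-- Sequences built by course-of-values recursion.

update : {A : ℕ → Set} → (∀ k → A k) → ∀ n → A n → ∀ k → A k
update f n a k with k ℕₚ.≟ n
... | yes refl = a
... | no  _    = f k

update-same : {A : ℕ → Set} (f : ∀ k → A k) (n : ℕ) (a : A n) → update f n a n ≡ a
update-same f n a with n ℕₚ.≟ n
... | yes refl = refl
... | no  n≢n  = ⊥-elim (n≢n refl)

update-other : {A : ℕ → Set} (f : ∀ k → A k) {n : ℕ} (a : A n) {k : ℕ} →
               k ≢ n → update f n a k ≡ f k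
update-other f {n} a {k} k≢n with k ℕₚ.≟ n
... | yes k≡n = ⊥-elim (k≢n k≡n)
... | no  _   = refl

-- Stage `n` stores the first `n` choices, with `f₀` as filler beyond them. As `R n` may inspect the
-- filler, it is claimed for the stage and not for `x`.
course-of-values-choice : {A : ℕ → Set} {R : ∀ n → (∀ k → A k) → A n → Set} →
  (∀ k → A k) → (∀ n f → ∃ (R n f)) →
  ∃ λ x → ∀ n → ∃ λ f → (∀ j → j ℕ.< n → f j ≡ x j) × R n f (x n)
course-of-values-choice {A} {R} f₀ next =
  x , λ n → stage n , stage-agrees n , proj₂ (next n (stage n))
  where
  stage : ℕ → ∀ k → A k
  stage zero    = f₀
  stage (suc n) = update (stage n) n (proj₁ (next n (stage n)))
  x : ∀ k → A k
  x n = proj₁ (next n (stage n))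
  stage-agrees : ∀ n j → j ℕ.< n → stage n j ≡ x j
  stage-agrees (suc n) j j<1+n with ℕₚ.m<1+n⇒m<n∨m≡n j<1+n
  ... | inj₁ j<n  = trans (update-other (stage n) _ (ℕₚ.<⇒≢ j<n)) (stage-agrees n j j<n)
  ... | inj₂ refl = update-same (stage n) n _

-- Points of `Z` and their distances.

growing : (f : ℕ → ℚ) → (∀ k → fromℕ k ≤ f k) → (∀ k → f k < f (suc k)) → Z
growing f lower incr = record
  { seq        = f
  ; nonneg     = λ k → nonNegative (≤-trans (fromℕ-mono-≤ ℕ.z≤n) (lower k))
  ; increasing = incr
  ; unbounded  = λ M → let (N , M≤N) = archimedean M in
                 suc N , λ n N<n → ≤-<-trans M≤N (<-≤-trans (fromℕ-mono-< N<n) (lower n))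
  }

seq-mono-≤ : ∀ Q {m n} → m ℕ.≤ n → seq Q m ≤ seq Q n
seq-mono-≤ Q {m} {n} m≤n = go (ℕₚ.≤⇒≤′ m≤n)
  where
  go : ∀ {n} → m ℕ.≤′ n → seq Q m ≤ seq Q n
  go (ℕ.≤′-reflexive refl) = ≤-refl
  go (ℕ.≤′-step m≤n)       = ≤-trans (go m≤n) (<⇒≤ (Z.increasing Q _))

-- A first difference at some `k ≤ n` makes the exponent at most `seq Q n ≤ fromℕ m`, hence the
-- distance at least `½ ^ m`.
close⇒agree : ∀ Q n → ∃ λ ε → 0ℚ < ε ×
  (∀ Q′ → d Q Q′ <ℝ fromℚ ε → ∀ j → j ℕ.≤ n → seq Q j ≡ seq Q′ j)
close⇒agree Q n = ½ ^ m , ^-pos m (from-yes (0ℚ <? ½)) , agree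
  where
  m : ℕ
  m = proj₁ (archimedean (seq Q n))
  agree : ∀ Q′ → d Q Q′ <ℝ fromℚ (½ ^ m) → ∀ j → j ℕ.≤ n → seq Q j ≡ seq Q′ j
  agree Q′ (r , (_ , r∈U) , r<½ᵐ) j j≤n with search Q Q′ (suc n)
  ... | inj₂ same = same j (ℕ.s≤s j≤n)
  ... | inj₁ (k , fd@(_ , <k≡)) with ℕₚ.<-≤-connex n k
  ...   | inj₁ n<k = <k≡ j (ℕₚ.≤-<-trans j≤n n<k)
  ...   | inj₂ k≤n = ⊥-elim (<-asym r<½ᵐ
    (2^-≥½^ m _ {{min-nonneg Q Q′ k}}
      (≤-trans (p⊓q≤p (seq Q k) (seq Q′ k))
        (≤-trans (seq-mono-≤ Q k≤n) (proj₂ (archimedean (seq Q n)))))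
      (r∈U k fd)))

<ℝ-respʳ-≈ : ∀ x P Q Q′ → Q ≈ Q′ → x <ℝ d P Q → x <ℝ d P Q′
<ℝ-respʳ-≈ _ P Q Q′ Q≈Q′ (r , r∈U , inj₁ r<0) = r , r∈U , inj₁ r<0
<ℝ-respʳ-≈ _ P Q Q′ Q≈Q′ (r , r∈U , inj₂ (k , (k≢ , <k≡) , r∈L)) =
  r , r∈U , inj₂ (k , ((λ eq → k≢ (trans eq (sym (Q≈Q′ k)))) ,
                       (λ j j<k → trans (<k≡ j j<k) (Q≈Q′ j))) ,
                  transport {{min-nonneg P Q′ k}} (Q≈Q′ k) r∈L)
  where
  -- With `q` a variable the equation can be matched with `refl`; the nonnegativity proof is
  -- irrelevant to the cut.
  transport : ∀ {q} .{{_ : NonNegative (seq P k ⊓ q)}} → seq Q k ≡ q →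
              ℝ.L (2^-min P Q k) r → ℝ.L (2^- (seq P k ⊓ q)) r
  transport refl l = l

FirstDifference⇒<ℝ : ∀ {P Q Q′ k l} →
  FirstDifference P Q k → FirstDifference P Q′ l →
  seq P l ⊓ seq Q′ l < seq P k ⊓ seq Q k → d P Q <ℝ d P Q′
FirstDifference⇒<ℝ {P} {Q} {Q′} {k} {l} fd fd′ lt
  with 2^-antimono-< _ _ {{min-nonneg P Q′ l}} {{min-nonneg P Q k}} lt
... | r , r∈U , r∈L =
  r , Equivalence.from (proj₂ (d-different {P} {Q} fd) r) r∈U ,
      Equivalence.from (proj₁ (d-different {P} {Q′} fd′) r) r∈L

-- The closed set and points built inside it.

Slow : Pred Z 0ℓ
Slow Q = ∀ n → seq Q n < fromℕ (suc n)

Slow-resp-≈ : Slow Respects _≈_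
Slow-resp-≈ Q≈Q′ slow n = subst (_< fromℕ (suc n)) (Q≈Q′ n) (slow n)

Slow-closed : IsClosed Slow
Slow-closed Q near n =
  let (ε , 0<ε , agree) = close⇒agree Q n
      (Q′ , slow , close) = near ε 0<ε
  in  subst (_< fromℕ (suc n)) (sym (agree Q′ close n ℕₚ.≤-refl)) (slow n)

-- Entries from these consecutive disjoint intervals can be chosen independently: monotonicity,
-- divergence and `Slow` are automatic.
Band : ℕ → Set
Band n = ∃ λ q → fromℕ n ≤ q × q < fromℕ (suc n)

value : (∀ k → Band k) → ℕ → ℚ
value f k = proj₁ (f k)

limit : (∀ k → Band k) → Z
limit f = growing (value f) (λ k → proj₁ (proj₂ (f k)))
  (λ k → <-≤-trans (proj₂ (proj₂ (f k))) (proj₁ (proj₂ (f (suc k)))))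

limit-Slow : ∀ f → Slow (limit f)
limit-Slow f k = proj₂ (proj₂ (f k))

-- From `n` on the bounds `fromℕ (suc k)` themselves serve as entries: they are the least values
-- that violate `Slow`, and they exceed every earlier band.
escape : (f : ∀ k → Band k) → ∀ n → ∃ λ Q →
         (∀ j → j ℕ.< n → seq Q j ≡ value f j) × seq Q n ≡ fromℕ (suc n)
escape f n = growing g lower incr , g-below , g-above ℕₚ.≤-refl
  where
  g : ℕ → ℚ
  g k with k ℕₚ.<? n
  ... | yes _ = value f k
  ... | no  _ = fromℕ (suc k)
  g-below : ∀ j → j ℕ.< n → g j ≡ value f j
  g-below j j<n with j ℕₚ.<? n
  ... | yes _  = refl
  ... | no j≮n = ⊥-elim (j≮n j<n)
  g-above : ∀ {k} → n ℕ.≤ k → g k ≡ fromℕ (suc k)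
  g-above {k} n≤k with k ℕₚ.<? n
  ... | yes k<n = ⊥-elim (ℕₚ.<⇒≱ k<n n≤k)
  ... | no _    = refl
  lower : ∀ k → fromℕ k ≤ g k
  lower k with k ℕₚ.<? n
  ... | yes _ = proj₁ (proj₂ (f k))
  ... | no  _ = fromℕ-mono-≤ (ℕₚ.n≤1+n k)
  incr : ∀ k → g k < g (suc k)
  incr k with ℕₚ.<-≤-connex k n
  ... | inj₁ k<n = subst (_< g (suc k)) (sym (g-below k k<n))
                     (<-≤-trans (proj₂ (proj₂ (f k))) (lower (suc k)))
  ... | inj₂ n≤k = subst₂ _<_ (sym (g-above n≤k)) (sym (g-above (ℕₚ.m≤n⇒m≤1+n n≤k)))
                     (fromℕ-mono-< ℕₚ.≤-refl)

-- Screening a point from the dense sequence.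

module _ (D : ℕ → Z) where

  -- The bound p + n, rather than p, covers the index i = n, so that the limit
  -- point differs from every D i.
  Trap : ∀ n → (∀ k → Band k) → Band n → Set
  Trap n f t = ∃ λ p → (∀ j → j ℕ.< n → seq (D p) j ≡ value f j) ×
    seq (D p) n ≡ fromℕ (suc n) ×
    (∀ i → i ℕ.≤ p ℕ.+ n → seq (D i) n < fromℕ (suc n) → seq (D i) n < proj₁ t)

  -- Density supplies a `D p` that agrees with the escaping point through `n`. Only then is `t`
  -- chosen, since the indices it must beat depend on `p`.
  trap : IsDense D → ∀ n f → ∃ (Trap n f)
  trap dense n f =
    let (Q , Q-below , Q-at) = escape f n
        (ε , 0<ε , agree) = close⇒agree Q n
        (p , close) = dense Q ε 0<ε
        (t , n≤t , t<1+n , above) = above-finitely-many (fromℕ-mono-< (ℕₚ.n<1+n n))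
                                      (λ i → seq (D i) n) (suc (p ℕ.+ n))
    in  (t , n≤t , t<1+n) , p ,
        (λ j j<n → trans (sym (agree (D p) close j (ℕₚ.<⇒≤ j<n))) (Q-below j j<n)) ,
        trans (sym (agree (D p) close n ℕₚ.≤-refl)) Q-at ,
        λ i i≤p+n → above i (ℕ.s≤s i≤p+n)

  -- The slack `n` lets the range of indices reach any prescribed one, such as the index of a route
  -- at a late time.
  Screened : Z → Set
  Screened x = (∀ i → ¬ x ≈ D i) × (∀ n → ∃ λ p → ∀ i → i ℕ.≤ p ℕ.+ n →
    Slow (D i) → d x (D p) <ℝ d x (D i))

  Trapped : (∀ k → Band k) → Set
  Trapped f = ∀ n → ∃ λ f′ → (∀ j → j ℕ.< n → f′ j ≡ f j) × Trap n f′ (f n)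

  -- The first difference from `D p` is at `n`, with exponent `seq x n`. As `seq (D i) n < seq x n`,
  -- the first difference from `D i` is at some `k ≤ n`, with exponent at most `seq (D i) n`.
  trap-nearer : ∀ f n {f′} → (∀ j → j ℕ.< n → f′ j ≡ f j) →
                (tr : Trap n f′ (f n)) → ∀ i → i ℕ.≤ proj₁ tr ℕ.+ n →
                Slow (D i) → d (limit f) (D (proj₁ tr)) <ℝ d (limit f) (D i)
  trap-nearer f n f′≡f (p , below , at , above) i i≤p+n slow =
    cases (search x (D i) (suc n))
    where
    x : Z
    x = limit f
    xₙ<Dₚ : seq x n < seq (D p) n
    xₙ<Dₚ = subst (seq x n <_) (sym at) (limit-Slow f n)
    fd : FirstDifference x (D p) n
    fd = <⇒≢ xₙ<Dₚ , λ j j<n → sym (trans (below j j<n) (cong proj₁ (f′≡f j j<n)))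
    Dᵢ<xₙ : seq (D i) n < seq x n
    Dᵢ<xₙ = above i i≤p+n (slow n)
    cases : ∃ (FirstDifference x (D i)) ⊎ (∀ j → j ℕ.< suc n → seq x j ≡ seq (D i) j) →
            d x (D p) <ℝ d x (D i)
    cases (inj₂ same) = ⊥-elim (<⇒≢ Dᵢ<xₙ (sym (same n ℕₚ.≤-refl)))
    cases (inj₁ (k , fd′@(_ , <k≡))) with ℕₚ.<-≤-connex n k
    ... | inj₁ n<k = ⊥-elim (<⇒≢ Dᵢ<xₙ (sym (<k≡ n n<k)))
    ... | inj₂ k≤n = FirstDifference⇒<ℝ {x} {D p} {D i} fd fd′ (subst (seq x k ⊓ seq (D i) k <_)
      (sym (p≤q⇒p⊓q≡p (<⇒≤ xₙ<Dₚ)))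
      (≤-<-trans (p⊓q≤q (seq x k) (seq (D i) k)) (≤-<-trans (seq-mono-≤ (D i) k≤n) Dᵢ<xₙ)))

  -- The trap at stage `i` also covers the index `i`: were the points equal, `seq (D i) i` would
  -- have to lie below itself.
  trap-avoids : ∀ f i {f′} → Trap i f′ (f i) → ¬ limit f ≈ D i
  trap-avoids f i (p , _ , _ , above) x≈Dᵢ = <-irrefl (sym (x≈Dᵢ i))
    (above i (ℕₚ.m≤n+m i p) (subst (_< fromℕ (suc i)) (x≈Dᵢ i) (limit-Slow f i)))

  Trapped⇒Screened : ∀ f → Trapped f → Screened (limit f)
  Trapped⇒Screened f trapped =
    (λ i → trap-avoids f i {proj₁ (trapped i)} (proj₂ (proj₂ (trapped i)))) ,
    (λ n → let (_ , f′≡f , tr) = trapped n in proj₁ tr , trap-nearer f n f′≡f tr)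

  screened : IsDense D → ∃ λ x → Slow x × Screened x
  screened dense = from (course-of-values-choice
    (λ k → fromℕ k , ≤-refl , fromℕ-mono-< (ℕₚ.n<1+n k)) (trap dense))
    where
    from : ∃ Trapped → ∃ λ x → Slow x × Screened x
    from (f , trapped) = limit f , limit-Slow f , Trapped⇒Screened f trapped

  -- Indices along a route that never reaches its target.

  module _ {x : Z} (x≉D : ∀ i → ¬ x ≈ D i) {s : ℕ → Z} (route : IsRoute D x s) where
    open IsRoute route

    mutual
      -- The next index exists only while the route has not reached `x`, which holds because its
      -- current point is a term of `D`; hence the mutual recursion.
      index : ℕ → ℕ
      index zero    = 0
      index (suc m) = proj₁ (step m (x≉s m))

      s≈D : ∀ m → s m ≈ D (index m)
      s≈D zero    = start
      s≈D (suc m) = proj₁ (proj₂ (step m (x≉s m)))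

      x≉s : ∀ m → ¬ x ≈ s m
      x≉s m x≈s = x≉D (index m) (λ k → trans (x≈s k) (s≈D m k))

    index-closer : ∀ m → d x (D (index (suc m))) <ℝ d x (D (index m))
    index-closer m =
      <ℝ-respʳ-≈ (d x (D (index (suc m)))) x (s m) (D (index m)) (s≈D m)
      (proj₁ (proj₂ (proj₂ (step m (x≉s m)))))

    index-least : ∀ m i → d x (D i) <ℝ d x (D (index m)) → index (suc m) ℕ.≤ i
    index-least m i closer = proj₂ (proj₂ (proj₂ (step m (x≉s m)))) i
      (<ℝ-respʳ-≈ (d x (D i)) x (D (index m)) (s m) (λ k → sym (s≈D m k)) closer)

    -- Distances decrease along the route, so a point closer than the current one was already a
    -- candidate when the current index was chosen as least.
    index-record : ∀ m i → d x (D i) <ℝ d x (D (index m)) → index m ℕ.≤ i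
    index-record zero    i closer = ℕ.z≤n
    index-record (suc m) i closer = index-least m i
      (<ℝ-trans {d x (D i)} {d x (D (index (suc m)))} {d x (D (index m))}
                closer (index-closer m))

    index-increasing : ∀ m → index m ℕ.< index (suc m)
    index-increasing m = ℕₚ.≤∧≢⇒< (index-record m (index (suc m)) (index-closer m))
      λ eq → <ℝ-irrefl {d x (D (index m))}
        (subst (λ i → d x (D i) <ℝ d x (D (index m))) (sym eq) (index-closer m))

    n≤index : ∀ n → n ℕ.≤ index n
    n≤index zero    = ℕ.z≤n
    n≤index (suc n) = ℕₚ.≤-trans (ℕ.s≤s (n≤index n)) (index-increasing n)

  -- While the current point is in `Slow` with index at most `p + n₀`, the point `D p` is closer to
  -- `x`, so the next index is at most `p`. The indices thus stay bounded, although they increase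
  -- strictly.
  route-leaves-Slow : ∀ {x} → Screened x → ∀ {s} → IsRoute D x s →
                      ∀ M → ¬ (∀ m → M ℕ.≤ m → Slow (s m))
  route-leaves-Slow {x} (x≉D , screen) {s} route M slow = stuck (screen n₀)
    where
    n₀ : ℕ
    n₀ = index x≉D route M
    stuck : ¬ (∃ λ p → ∀ i → i ℕ.≤ p ℕ.+ n₀ → Slow (D i) → d x (D p) <ℝ d x (D i))
    -- After `suc (p + n₀)` further steps the index exceeds `p + n₀`.
    stuck (p , nearer) = ℕₚ.<⇒≱ (ℕₚ.≤-trans (ℕₚ.m≤m+n (suc (p ℕ.+ n₀)) M)
      (n≤index x≉D route (suc (p ℕ.+ n₀) ℕ.+ M))) (bounded (suc (p ℕ.+ n₀)))
      where
      bounded : ∀ k → index x≉D route (k ℕ.+ M) ℕ.≤ p ℕ.+ n₀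
      bounded zero    = ℕₚ.m≤n+m n₀ p
      bounded (suc k) = ℕₚ.≤-trans
        (index-least x≉D route (k ℕ.+ M) p (nearer _ (bounded k)
          (Slow-resp-≈ {s (k ℕ.+ M)} {D (index x≉D route (k ℕ.+ M))}
            (s≈D x≉D route (k ℕ.+ M)) (slow (k ℕ.+ M) (ℕₚ.m≤n+m M k)))))
        (ℕₚ.m≤m+n p n₀)

theorem12 : ∃ λ (F : Pred Z 0ℓ) → F Respects _≈_ × IsClosed F × ¬ FirstReturnRecoverable (characteristic F)
theorem12 = Slow , (λ {Q} {Q′} → Slow-resp-≈ {Q} {Q′}) , Slow-closed , not-recoverable
  where
  not-recoverable : ¬ FirstReturnRecoverable (characteristic Slow)
  not-recoverable (D , dense , recover) =
    let (x , slow , x-screened) = screened D dense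
        (s , route , converges) = recover x
        (M , eventually) = converges 1F slow
    in  route-leaves-Slow D x-screened route M eventually
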